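{- Let $(S,M)$ be a marked surface, $T$ a tagged triangulation satisfying (A1), and $\delta$ a tagged arc with $\overline\delta\notin T$ satisfying (A2). For every perfect matching $E$ of the bipartite graph $B_\delta$ associated with $T_\delta$, one has $I(E)=Y(\varpi^{ -1}(E))$ as sets of diagonals of $T_\delta$.
   Context: Surface setting. A marked surface $(S,M)$: $S$ is a connected compact oriented Riemann surface with possibly empty boundary, $M\subset S$ a non-empty finite set with at least one point on each boundary component; punctures are the points of $M$ in the interior. Excluded: a monogon with at most one puncture, an unpunctured digon or triangle, a sphere with at most three punctures. Arcs, ideal triangulations, tagged arcs and tagged triangulations are in the sense of Fomin–Shapiro–Thurston; if $S$ is closed with exactly one puncture, all tagged arcs are plain. $\overline\delta$ is the plain arc underlying $\delta$; for a plain arc $\gamma$ with endpoints $p,q$, $\gamma^{(p)}$ is $\gamma$ notched at $p$ and $\gamma^{(pq)}$ is $\gamma$ notched at both ends. (A1) $T$ consists of plain and 1-notched arcs, and for each puncture at most one 1-notched arc of $T$ has its notched end there. (A2) No 1-notched arc of $T$ has its notched end at a puncture where $\delta$ is notched. $T^0$ is the ideal triangulation obtained from $T$ by replacing every 1-notched arc (plain at $o$, notched at $r$) by the loop at $o$ around it cutting out a monogon containing only the puncture $r$. Polygon $T_\delta$. Let $\gamma=\overline\delta$, oriented from $q$ to $p$; $\tau_1,\dots,\tau_n$ the arcs of $T^0$ crossed by $\gamma$ in order, $\triangle_0,\dots,\triangle_n$ the triangles passed through. $T_\gamma$ is the triangulated $(n+3)$-gon obtained from copies of $\triangle_0,\dots,\triangle_n$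 (a self-folded triangle is cut open along its radius) by gluing the copies of $\triangle_{i-1},\triangle_i$ along $\tau_i$. $T_{\gamma^{(p)}}$ is obtained from $T_\gamma$ by gluing on copies of triangles, one for each corner at $p$ of a triangle of $T^0$ other than the corner through which $\gamma$ reaches $p$, cyclically around $p$ as in the surface, so that $p$ becomes an interior vertex (puncture) of a triangulated polygon; $T_{\gamma^{(pq)}}$: the same at both ends. Gluing edges are diagonals, other edges boundary segments. $\zeta_1,\dots,\zeta_m$ (resp. $\xi_1,\dots,\xi_\ell$) are the diagonals of $T_\delta$ at the puncture $p$ (resp. $q$), counterclockwise around it, with $\tau_n,\zeta_1,\zeta_m$ (resp. $\tau_1,\xi_1,\xi_\ell$) in one triangle. A perfect matching of angles in $T_\delta$ is a set of angles of its triangles containing exactly one angle at each vertex incident to at least one diagonal and exactly one angle of each triangle; $\mathbb{A}(T_\delta)$ is the set of these. The minimal matching $A_-(T_\delta)\in\mathbb{A}(T_\delta)$ is the unique one such that at each boundary vertex $v$ incident to a diagonal its angle at $v$ comes first in counterclockwise order around $v$. An exterior angle is an angle between a boundary segment and a diagonal. For $A\in\mathbb{A}(T_\delta)$, $Y'(A)$ is the set of diagonals that are sides of at least one exterior angle in $A_-(T_\delta)\triangle A$ (symmetric difference). $Y(A)=Y'(A)\sqcup\{\tau_1\}$ if $\delta=\gamma^{(pq)}$, $n=1$ and $A$ contains at least one of the four angles between ($\zeta_m$ or $\xi_\ell$) and ($\tau_1$ or a boundary segment); otherwise $Y(A)=Y'(A)$. $B_\delta$: black vertices are the vertices of $T_\delta$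 incident to at least one diagonal, white vertices are the triangles of $T_\delta$; each triangle is joined to those of its vertices that are black. $B_\delta$ is drawn in the plane inside $T_\delta$. $\varpi$ sends the angle at a black vertex $v$ in a triangle $\triangle$ to the edge $v\triangle$; it induces a bijection from $\mathbb{A}(T_\delta)$ to perfect matchings of $B_\delta$. $E_-(B_\delta):=\varpi(A_-(T_\delta))$. For each diagonal $\tau$ the square labelled $\tau$ is the 4-cycle face of $B_\delta$ with white vertices the two triangles containing $\tau$ and black vertices the endpoints of $\tau$. For a perfect matching $E$ of $B_\delta$, $E_-(B_\delta)\triangle E$ consists of all boundary edges of a subgraph $B_E$ that is a union of squares (a boundary edge being an edge lying in exactly one of these squares), and $I(E)$ is the set of (labels of) squares contained in $B_E$. -}

module Defs where

open import Level using (0ℓ)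
open import Data.Bool using (Bool; true; false; T; _∧_)
open import Data.Nat as ℕ using (ℕ; zero; suc; _∸_)
open import Data.Fin as Fin using (Fin; zero; suc; toℕ; fromℕ; inject₁; opposite)
import Data.Fin.Properties as Fin
open import Data.Fin.Relation.Unary.Top using (view; ‵fromℕ; ‵inject₁)
open import Data.Integer as ℤ using (ℤ; -_)
import Data.Irrelevant as Irrelevant
open import Data.Product using (Σ; ∃; ∃!; ∃-syntax; _×_; _,_; proj₁; proj₂)
import Data.Product.Properties as Product
open import Data.Refinement using (Refinement-syntax; value; proof; _,_)
open import Data.Sum using (_⊎_; inj₁; inj₂)
open import Relation.Binary using (Rel; DecidableEquality)
open import Relation.Binary.Construct.Closure.Equivalence as Eq using (EqClosure)
import Relation.Binary.Construct.Closure.Symmetric as Sym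
open import Relation.Binary.Construct.Closure.ReflexiveTransitive as Star using (Star)
open import Relation.Binary.PropositionalEquality
  using (_≡_; _≢_; refl; sym; trans; cong)
open import Relation.Nullary using (¬_; yes; no)
open import Relation.Unary using (Pred; _∈_; _∉_; _⊆_)

------------------------------------------------------------------------
-- Oriented triangles glued along sides

next prev : Fin 3 → Fin 3
next zero             = suc zero
next (suc zero)       = suc (suc zero)
next (suc (suc zero)) = zero
prev zero             = suc (suc zero)
prev (suc zero)       = zero
prev (suc (suc zero)) = suc zero

prev-next : ∀ i → prev (next i) ≡ i
prev-next zero             = refl
prev-next (suc zero)       = refl
prev-next (suc (suc zero)) = refl

-- The corners 0, 1, 2 of a triangle are in counterclockwise order, and side i
-- runs from corner i to corner `next i`.  So one pair (t , i) denotes both a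
-- corner (angle) and the side leaving it counterclockwise along ∂t.

Flag : Set → Set
Flag Tri = Tri × Fin 3

module _ {Tri : Set} where

  triangle : Flag Tri → Tri
  triangle = proj₁

  -- The angle at the corner c is swept counterclockwise from the side
  -- `right c` to the side `left c`.

  right left : Flag Tri → Flag Tri
  right c       = c
  left  (t , i) = t , prev i

  -- The corner at which the side s ends, and the one opposite to s.

  end opposite-corner : Flag Tri → Flag Tri
  end             (t , i) = t , next i
  opposite-corner (t , i) = t , prev i

-- s ⋈ s′ : the sides s and s′ are glued to each other, always reversing the
-- boundary orientations, so that the start of s is the end of s′.

module Gluing {Tri : Set} (_⋈_ : Rel (Flag Tri) 0ℓ) where

  Corner Side : Set
  Corner = Flag Tri
  Side   = Flag Tri

  Glued Boundary : Pred Side 0ℓ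
  Glued    s = ∃[ s′ ] s ⋈ s′
  Boundary s = ¬ Glued s

  -- d is the angle following c counterclockwise around their common vertex.

  _↷_ : Rel Corner 0ℓ
  c ↷ d = left c ⋈ right d

  -- Vertices of the glued surface are corners up to _~_.

  infix 4 _~_
  _~_ : Rel Corner 0ℓ
  _~_ = EqClosure _↷_

  Interior BoundaryVertex : Pred Corner 0ℓ
  Interior       v = ∀ c → c ~ v → Glued (right c) × Glued (left c)
  BoundaryVertex v = ∃[ c ] (c ~ v × (Boundary (right c) ⊎ Boundary (left c)))

  -- At a boundary vertex the angles are linearly ordered by _↷_.

  First : Pred Corner 0ℓ
  First c = ∀ d → ¬ d ↷ c

------------------------------------------------------------------------
-- Marked surfaces with an ideal triangulation

-- A marked surface together with an ideal triangulation is a connected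
-- oriented gluing of finitely many triangles: the marked points are the
-- vertices, the punctures are the interior vertices.  A side with
-- mate s ≡ s is a boundary segment (in an oriented surface no side is glued to
-- itself); two sides of one triangle may be glued (self-folded triangle).
--
-- A monogon, digon or triangle without punctures and a monogon with one
-- puncture have at most one triangle; by the Euler characteristic the
-- triangulated spheres with at most three punctures are the closed gluings of
-- two triangles having three vertices.

record IdealTriangulation : Set where
  field
    N               : ℕ
    mate            : Flag (Fin N) → Flag (Fin N)
    mate-involutive : ∀ s → mate (mate s) ≡ s

  Tri : Set
  Tri = Fin N

  _⋈_ : Rel (Flag Tri) 0ℓ
  s ⋈ s′ = mate s ≡ s′ × s ≢ s′

  open Gluing _⋈_ public

  Adjacent : Rel Tri 0ℓ
  Adjacent t t′ = ∃[ i ] ∃[ j ] (t , i) ⋈ (t′ , j)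

  Puncture : Pred Corner 0ℓ
  Puncture = Interior

  Closed : Set
  Closed = ∀ s → Glued s

  field
    connected        : ∀ t t′ → EqClosure Adjacent t t′
    at-least-two     : 2 ℕ.≤ N
    not-small-sphere : ¬ (N ≡ 2 × Closed ×
      ∃[ c₁ ] ∃[ c₂ ] ∃[ c₃ ] (¬ c₁ ~ c₂ × ¬ c₂ ~ c₃ × ¬ c₁ ~ c₃))

  _≟_ : DecidableEquality Corner
  _≟_ = Product.≡-dec Fin._≟_ Fin._≟_

  OncePuncturedClosed : Set
  OncePuncturedClosed = Closed × (∀ c d → c ~ d)

  -- c is the corner of a self-folded triangle at its enclosed puncture: both
  -- sides at c are the radius, and the side opposite to c is the loop.

  Enclosed : Pred Corner 0ℓ
  Enclosed c = mate (right c) ≡ left c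

  ccw cw : Corner → Corner
  ccw c = mate (left c)
  cw  c = end (mate (right c))

  ccw-~ : ∀ {v} → Puncture v → ∀ c → c ~ v → ccw c ~ v
  ccw-~ pv c c~v with proj₂ (pv c c~v)
  ... | _ , refl , ≢ = Eq.symmetric _↷_ (Sym.fwd (refl , ≢) Star.◅ Star.ε) Star.◅◅ c~v

  cw-~ : ∀ {v} → Puncture v → cw v ~ v
  cw-~ {v} pv with proj₁ (pv v Star.ε)
  ... | _ , refl , ≢ = Sym.fwd lemma Star.◅ Star.ε
    where
    left-cw : left (cw v) ≡ mate v
    left-cw = cong (triangle (mate v) ,_) (prev-next (proj₂ (mate v)))
    lemma : cw v ↷ v
    lemma = trans (cong mate left-cw) (mate-involutive v)
          , λ eq → ≢ (trans (sym eq) left-cw)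

------------------------------------------------------------------------
-- Tagged triangulations

-- A tagged triangulation T is given by its underlying ideal triangulation T°
-- together with the tags of its arcs at each marked point.  At a puncture
-- enclosed by a self-folded triangle of T°, T has exactly two arc ends, a
-- plain and a notched one, on the same underlying arc (the radius); `notched`
-- is set to false there.

record TaggedTriangulation : Set where
  field
    ideal : IdealTriangulation
  open IdealTriangulation ideal public
  field
    notched          : Corner → Bool
    notched-~        : ∀ {c d} → c ~ d → notched c ≡ notched d
    notched-puncture : ∀ {c} → notched c ≡ true → Puncture c
    notched-enclosed : ∀ {c} → Enclosed c → notched c ≡ false
    notched-closed   : OncePuncturedClosed → ∀ c → notched c ≡ false

  -- ArcOfT s a b : the underlying arc of T° carried by the side s, oriented as
  -- s, belongs to T with tags a at its start and b at its end (true = notched).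
  -- The loop of a self-folded triangle is not itself in T; it corresponds to
  -- the radius notched at the enclosed puncture.

  data ArcOfT : Side → Bool → Bool → Set where
    ordinary : ∀ {s} → Glued s →
               ¬ Enclosed (opposite-corner s) →
               ¬ Enclosed (opposite-corner (mate s)) →
               ArcOfT s (notched s) (notched (mate s))
    loop     : ∀ {c} → Enclosed c → ArcOfT (right c) true (notched (mate c))
    reversed : ∀ {s a b} → ArcOfT s a b → ArcOfT (mate s) b a

  -- Under A1 the triangulation T⁰ is the underlying ideal triangulation T°.

  A1 : Set
  A1 = (∀ {s a b} → ArcOfT s a b → a ∧ b ≡ false)
     × (∀ {s s′} → ArcOfT s true false → ArcOfT s′ true false → s ~ s′ →
        s ≡ s′ ⊎ s ≡ mate s′)

------------------------------------------------------------------------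
-- Arcs

-- Points on the boundary of a triangle, ordered along it from corner 0 on; a
-- point of the open side i is given by a coordinate increasing along side i.

data Mark : Set where
  corner : Fin 3 → Mark
  point  : Fin 3 → ℤ → Mark

data _≺_ : Rel Mark 0ℓ where
  corner-corner : ∀ {i j}     → i Fin.< j → corner i  ≺ corner j
  corner-point  : ∀ {i j y}   → i Fin.≤ j → corner i  ≺ point j y
  point-corner  : ∀ {i j x}   → i Fin.< j → point i x ≺ corner j
  point-point   : ∀ {i j x y} → i Fin.< j → point i x ≺ point j y
  same-side     : ∀ {i x y}   → x ℤ.< y   → point i x ≺ point i y

Between Outside : Mark → Mark → Pred Mark 0ℓ
Between a b c = (a ≺ c × c ≺ b) ⊎ (b ≺ c × c ≺ a)
Outside a b c = (c ≺ a × c ≺ b) ⊎ (a ≺ c × b ≺ c)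

-- The chord ab crosses the chord cd in the interior of the triangle.

Cross : (a b c d : Mark) → Set
Cross a b c d = (Between a b c × Outside a b d) ⊎ (Outside a b c × Between a b d)

data Direction : Set where
  counterclockwise clockwise : Direction

data End : Set where
  at-p at-q : End

-- The tagged versions γ, γ⁽ᵖ⁾ and γ⁽ᵖᵠ⁾ of γ; if exactly one end is notched,
-- that end is called p.

data Tagging : Set where
  ⟨⟩ ⟨p⟩ ⟨pq⟩ : Tagging

notched-at : Tagging → End → Bool
notched-at ⟨⟩   _    = false
notched-at ⟨p⟩  at-p = true
notched-at ⟨p⟩  at-q = false
notched-at ⟨pq⟩ _    = true

module _ (𝕋 : TaggedTriangulation) where
  open TaggedTriangulation 𝕋

  -- A plain arc γ that is not an arc of T⁰, oriented from q to p, up to isotopy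
  -- (see Simple for the absence of self-intersections).  In minimal position
  -- with T⁰ it is determined by the sides s 0, …, s (n - 1) through which it
  -- leaves △₀, …, △ₙ₋₁; minimality means that γ never leaves a triangle through
  -- the side by which it came, and that its first and last segments join a
  -- corner to the opposite side.
  -- As the sides of a self-folded triangle are distinguished, every passage
  -- through it is a passage through the triangle cut open along the radius.

  record Path : Set where
    field
      len : ℕ

    n : ℕ
    n = suc len

    field
      s           : Fin n → Side
      s-glued     : ∀ i → Glued (s i)
      consecutive : ∀ (i : Fin len) →
                    triangle (s (suc i)) ≡ triangle (mate (s (inject₁ i)))
      reduced     : ∀ (i : Fin len) → s (suc i) ≢ mate (s (inject₁ i))

    tri : Fin (suc n) → Tri
    tri zero    = triangle (s zero)
    tri (suc i) = triangle (mate (s i))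

    q p : Corner
    q = opposite-corner (s zero)
    p = opposite-corner (mate (s (fromℕ len)))

    endpoint : End → Corner
    endpoint at-p = p
    endpoint at-q = q

    -- The i-th crossing has coordinate pos i along s i, hence - pos i along
    -- mate (s i).

    entry exit : (Fin n → ℤ) → Fin (suc n) → Mark
    entry pos zero    = corner (proj₂ q)
    entry pos (suc i) = point (proj₂ (mate (s i))) (- pos i)
    exit pos k with view k
    ... | ‵fromℕ     = corner (proj₂ p)
    ... | ‵inject₁ i = point (proj₂ (s i)) (pos i)

    -- γ has no self-intersection: the crossing points can be placed on the
    -- sides such that no two segments of γ in a triangle cross.

    Simple : Set
    Simple = ∃[ pos ]
        (∀ i j → i ≢ j → (s i ≡ s j      → pos i ≢ pos j)
                       × (s i ≡ mate (s j) → pos i ≢ - pos j))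
      × (∀ k l → k ≢ l → tri k ≡ tri l →
           ¬ Cross (entry pos k) (exit pos k) (entry pos l) (exit pos l))

  record Arc : Set where
    field
      path : Path
    open Path path public
    field
      simple : Simple

  module _ (γ : Arc) where
    open Arc γ

    -- Turn d s c c′ : crossing the side s while turning around the common
    -- vertex of c and c′ leads from the angle c to the angle c′.

    Turn : Direction → Side → Rel Corner 0ℓ
    Turn counterclockwise s c c′ = left  c ≡ s × c′ ≡ mate s
    Turn clockwise        s c c′ = right c ≡ s × c′ ≡ end (mate s)

    -- γ cuts out a monogon with one puncture r: it is the boundary of a
    -- neighbourhood of an arc η from q to r.  It follows η through k
    -- crossings, then makes one turn around r, then follows η back.  If k = 0
    -- then η is an arc of T⁰, and the turn crosses all other arc ends at r;
    -- if k > 0 then the turn crosses all arc ends of T⁰ at r.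

    record CutsOutOncePuncturedMonogon : Set where
      field
        k       : ℕ
        d       : Direction
        c       : ℕ → Corner
        retrace : ∀ i → toℕ i ℕ.< k → s (opposite i) ≡ mate (s i)
        turn    : ∀ i → k ℕ.≤ toℕ i → toℕ i ℕ.+ k ℕ.< n →
                  Turn d (s i) (c (toℕ i)) (c (suc (toℕ i)))
        closing : (k ≡ 0 × ∃[ s′ ] Turn d s′ (c n) (c 0))
                ⊎ (0 ℕ.< k × c (n ∸ k) ≡ c k)
        r≁q     : ¬ c k ~ q

  record TaggedArc : Set where
    field
      γ   : Arc
      tag : Tagging
    open Arc γ public

    Notched : Pred End 0ℓ
    Notched e = T (notched-at tag e)

    field
      no-monogon  : ¬ CutsOutOncePuncturedMonogon γ
      at-puncture : ∀ e → Notched e → Puncture (endpoint e)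
      loop-tags   : p ~ q → notched-at tag at-p ≡ notched-at tag at-q
      closed-tags : OncePuncturedClosed → tag ≡ ⟨⟩

    A2 : Set
    A2 = ∀ e → Notched e → ∀ {s} → ArcOfT s true false → ¬ s ~ endpoint e

------------------------------------------------------------------------
-- Triangulated polygons, matchings of angles and bipartite graphs

_⊖_ : {A : Set} → Pred A 0ℓ → Pred A 0ℓ → Pred A 0ℓ
(P ⊖ Q) x = (x ∈ P × x ∉ Q) ⊎ (x ∈ Q × x ∉ P)

module Polygon {Tri Diagonal : Set} (lhs rhs : Diagonal → Flag Tri) where

  _⋈_ : Rel (Flag Tri) 0ℓ
  s ⋈ s′ = ∃[ d ] ((s ≡ lhs d × s′ ≡ rhs d) ⊎ (s ≡ rhs d × s′ ≡ lhs d))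

  open Gluing _⋈_ public

  infix 4 _isSide_
  _isSide_ : Diagonal → Pred Side 0ℓ
  d isSide s = s ≡ lhs d ⊎ s ≡ rhs d

  -- The angle c is between a side in P and a side in R.

  AngleBetween : (P R : Pred Side 0ℓ) → Pred Corner 0ℓ
  AngleBetween P R c = (P (right c) × R (left c)) ⊎ (R (right c) × P (left c))

  Exterior : Pred Corner 0ℓ
  Exterior = AngleBetween Boundary Glued

  -- Vertices incident to at least one diagonal.

  Black : Pred Corner 0ℓ
  Black v = ∃[ c ] (c ~ v × (Glued (right c) ⊎ Glued (left c)))

  record AngleMatching (A : Pred Corner 0ℓ) : Set where
    field
      at-vertex   : ∀ v → Black v → ∃! _≡_ λ c → c ~ v × c ∈ A
      in-triangle : ∀ t → ∃! _≡_ λ i → (t , i) ∈ A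

  record Minimal (A : Pred Corner 0ℓ) : Set where
    field
      matching : AngleMatching A
      first    : ∀ c → c ∈ A → Black c → BoundaryVertex c → First c

  Y′ : (A₋ A : Pred Corner 0ℓ) → Pred Diagonal 0ℓ
  Y′ A₋ A d = ∃[ c ] (c ∈ A₋ ⊖ A × Exterior c × (d isSide right c ⊎ d isSide left c))

  -- The bipartite graph.  An edge joins a black vertex, represented by any of
  -- its corners, to a triangle; sets of edges are closed under _~_.

  EdgeSet : Set₁
  EdgeSet = Pred (Corner × Tri) 0ℓ

  IsEdge : EdgeSet
  IsEdge (v , t) = Black v × ∃[ i ] (t , i) ~ v

  record PerfectMatching (E : EdgeSet) : Set where
    field
      resp     : ∀ {v w t} → v ~ w → (v , t) ∈ E → (w , t) ∈ E
      edges    : E ⊆ IsEdge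
      at-black : ∀ v → Black v → ∃! _≡_ λ t → (v , t) ∈ E
      at-white : ∀ t → ∃! _~_ λ v → (v , t) ∈ E

  ϖ : Corner → Corner × Tri
  ϖ c = c , triangle c

  ϖ-image : Pred Corner 0ℓ → EdgeSet
  ϖ-image A (v , t) = ∃[ c ] (c ∈ A × c ~ v × triangle c ≡ t)

  ϖ⁻¹ : EdgeSet → Pred Corner 0ℓ
  ϖ⁻¹ E c = ϖ c ∈ E

  □ : Diagonal → EdgeSet
  □ d (v , t) = (v ~ lhs d ⊎ v ~ end (lhs d))
              × (t ≡ triangle (lhs d) ⊎ t ≡ triangle (rhs d))

  -- The union of the squares with labels in Q, its boundary edges, and the
  -- labels of the squares contained in it.

  ⋃□ ∂□ : Pred Diagonal 0ℓ → EdgeSet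
  ⋃□ Q e = ∃[ d ] (d ∈ Q × e ∈ □ d)
  ∂□ Q e = ∃! _≡_ λ d → d ∈ Q × e ∈ □ d

  Squares-in : EdgeSet → Pred Diagonal 0ℓ
  Squares-in B d = □ d ⊆ B

------------------------------------------------------------------------
-- The polygon T_δ

module T_δ {𝕋 : TaggedTriangulation} (δ : TaggedArc 𝕋) where
  open TaggedTriangulation 𝕋
    using (mate; _~_; ccw; cw; ccw-~; cw-~; _≟_)
    renaming (Corner to Corner⁰)
  open TaggedArc δ

  -- `△ i` is the copy of the i-th triangle passed through by γ; `ring e c` is
  -- the copy, at a notched end e, of the triangle of the corner c at that end.
  -- Copies keep the labels of corners and sides.

  data Copy : Set where
    △    : Fin (suc n) → Copy
    ring : (e : End) → .(Notched e) →
           [ c ∈ Corner⁰ ∣ c ~ endpoint e × c ≢ endpoint e ] → Copy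

  -- The triangle of γ containing the end e.

  hub : End → Fin (suc n)
  hub at-p = fromℕ n
  hub at-q = zero

  CornerAt : End → Set
  CornerAt e = [ c ∈ Corner⁰ ∣ c ~ endpoint e ]

  copy : (e : End) → .(Notched e) → CornerAt e → Copy
  copy e ν (c , c~e) with c ≟ endpoint e
  ... | yes _  = △ (hub e)
  ... | no c≢e = ring e ν (c , Irrelevant.map (_, c≢e) c~e)

  turn : (e : End) → .(Notched e) → CornerAt e → CornerAt e
  turn e ν (c , Irrelevant.[ c~e ]) =
    ccw c , Irrelevant.[ ccw-~ (at-puncture e ν) c c~e ]

  -- `τ i` is τ₁, …, τₙ numbered from 0; `spoke e ν c` is the diagonal at the
  -- puncture e following the corner c counterclockwise.

  data Diagonal : Set where
    τ     : Fin n → Diagonal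
    spoke : (e : End) → .(Notched e) → CornerAt e → Diagonal

  lhs rhs : Diagonal → Flag Copy
  lhs (τ i)         = △ (inject₁ i) , proj₂ (s i)
  lhs (spoke e ν c) = copy e ν c , proj₂ (left (value c))
  rhs (τ i)         = △ (suc i) , proj₂ (mate (s i))
  rhs (spoke e ν c) = copy e ν (turn e ν c) , proj₂ (right (value (turn e ν c)))

  open Polygon lhs rhs public

  -- ζₘ (at p) and ξ_ℓ (at q): counterclockwise from the side τₙ (resp. τ₁) of
  -- the hub triangle come ζ₁, …, ζₘ, i.e. the hub triangle is swept from ζₘ
  -- to ζ₁ counterclockwise around p.

  last-spoke : (e : End) → .(Notched e) → Diagonal
  last-spoke e ν =
    spoke e ν (cw (endpoint e) , Irrelevant.[ cw-~ (at-puncture e ν) ])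

  Special : Pred Corner 0ℓ
  Special c = Σ (End) λ e → Σ (Notched e) λ ν →
    AngleBetween (last-spoke e ν isSide_) (λ s → τ zero isSide s ⊎ Boundary s) c

  Y : (A₋ A : Pred Corner 0ℓ) → Pred Diagonal 0ℓ
  Y A₋ A d = d ∈ Y′ A₋ A
           ⊎ (tag ≡ ⟨pq⟩ × n ≡ 1 × (∃[ c ] (c ∈ A × c ∈ Special)) × d ≡ τ zero)

{-# OPTIONS --safe #-}
module Submission where

-- An angle c lies in the square of a diagonal d iff d is a side of c, because
-- the three vertices of a triangle of T_δ are distinct.  An exterior angle has
-- only one diagonal as a side, so it lies in A₋ ⊖ A iff that diagonal is in Q.
-- Every diagonal is a side of an exterior angle, except τ₁ if n = 1 and both
-- ends are notched; in that case τ₁ ∈ Q is read off at a boundary vertex from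
-- its last two angles, which are the special ones.

open import Defs
open import Level using (0ℓ)
open import Relation.Unary using (Pred; Decidable; _≐_)

open import Data.Bool using (T; true; false; _∧_)
open import Data.Empty using (⊥-elim-irr)
open import Data.Fin as Fin using (Fin; zero; suc; fromℕ; inject₁)
import Data.Fin.Properties as Fin
import Data.Irrelevant as Irrelevant
open import Data.Nat using (zero; suc)
open import Data.Product using (_×_; _,_; proj₁; proj₂; ∃-syntax)
open import Data.Refinement using (value; _,_)
open import Data.Sum using (_⊎_; inj₁; inj₂; [_,_]′)
open import Data.Sum.Properties using (inj₁-injective; inj₂-injective)
open import Function using (id; _∘_)
open import Relation.Binary.Construct.Closure.Equivalence as Eq using ()
open import Relation.Binary.Construct.Closure.ReflexiveTransitive using (ε; _◅◅_)
open import Relation.Binary.PropositionalEquality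
  using (_≡_; _≢_; refl; sym; trans; cong; cong₂; subst; isEquivalence)
open import Relation.Nullary using (¬_; yes; no; contradiction)
open import Relation.Nullary.Decidable using (toSum)
open import Relation.Unary using (_∈_; _∉_)

-- Cyclic order of the corners of a triangle, and strips of triangles.

next-prev : ∀ i → next (prev i) ≡ i
next-prev zero             = refl
next-prev (suc zero)       = refl
next-prev (suc (suc zero)) = refl

prev-prev : ∀ i → prev (prev i) ≡ next i
prev-prev zero             = refl
prev-prev (suc zero)       = refl
prev-prev (suc (suc zero)) = refl

next≢ : ∀ i → next i ≢ i
next≢ zero             ()
next≢ (suc zero)       ()
next≢ (suc (suc zero)) ()

prev≢ : ∀ i → prev i ≢ i
prev≢ zero             ()
prev≢ (suc zero)       ()
prev≢ (suc (suc zero)) ()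

next≢prev : ∀ i → next i ≢ prev i
next≢prev zero             ()
next≢prev (suc zero)       ()
next≢prev (suc (suc zero)) ()

data Around (i : Fin 3) : Fin 3 → Set where
  here   : Around i i
  after  : Around i (next i)
  before : Around i (prev i)

around : ∀ i j → Around i j
around zero             zero             = here
around zero             (suc zero)       = after
around zero             (suc (suc zero)) = before
around (suc zero)       zero             = before
around (suc zero)       (suc zero)       = here
around (suc zero)       (suc (suc zero)) = after
around (suc (suc zero)) zero             = after
around (suc (suc zero)) (suc zero)       = before
around (suc (suc zero)) (suc (suc zero)) = here

third : ∀ {i j : Fin 3} → i ≢ j → ∃[ k ] k ≢ i × k ≢ j
third {i} {j} i≢j with around i j
... | here   = contradiction refl i≢j
... | after  = prev i , prev≢ i , next≢prev i ∘ sym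
... | before = next i , next≢ i , next≢prev i

module _ {A : Set} where

  select : Fin 3 → A → A → A → Fin 3 → A
  select i x y z j with around i j
  ... | here   = x
  ... | after  = y
  ... | before = z

  select-here : ∀ i {x y z} → select i x y z i ≡ x
  select-here zero             = refl
  select-here (suc zero)       = refl
  select-here (suc (suc zero)) = refl

  select-after : ∀ i {x y z} → select i x y z (next i) ≡ y
  select-after zero             = refl
  select-after (suc zero)       = refl
  select-after (suc (suc zero)) = refl

  select-before : ∀ i {x y z} → select i x y z (prev i) ≡ z
  select-before zero             = refl
  select-before (suc zero)       = refl
  select-before (suc (suc zero)) = refl

  select-injective : ∀ i {x y z} → x ≢ y → y ≢ z → x ≢ z →
                     ∀ {j k} → select i x y z j ≡ select i x y z k → j ≡ k
  select-injective i x≢y y≢z x≢z {j} {k} eq with around i j | around i k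
  ... | here   | here   = refl
  ... | here   | after  = contradiction eq x≢y
  ... | here   | before = contradiction eq x≢z
  ... | after  | here   = contradiction (sym eq) x≢y
  ... | after  | after  = refl
  ... | after  | before = contradiction eq y≢z
  ... | before | here   = contradiction (sym eq) x≢z
  ... | before | after  = contradiction (sym eq) y≢z
  ... | before | before = refl

-- The corners of a triangle, named by their mirror images in the neighbouring
-- triangle: side j of the former is glued to side i of the latter.

reflect : Fin 3 → Fin 3 → Fin 3 → Fin 3
reflect i j = select j (next i) i (prev i)

reflect-injective : ∀ i j {k l} → reflect i j k ≡ reflect i j l → k ≡ l
reflect-injective i j = select-injective j (next≢ i) (prev≢ i ∘ sym) (next≢prev i)

-- Corner `j` of the `i`-th triangle of a strip is unfolded by successive reflections to a corner of
-- the first triangle. This corner will be its colour.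
strip : ∀ {m} (σ ρ : Fin m → Fin 3) → Fin (suc m) → Fin 3 → Fin 3
strip         σ ρ zero    = id
strip {suc m} σ ρ (suc i) = reflect (σ zero) (ρ zero) ∘ strip (σ ∘ suc) (ρ ∘ suc) i

-- `strip` recurses from the front of the strip, whereas comparing neighbouring triangles requires
-- the last reflection to be split off.
strip-suc : ∀ {m} (σ ρ : Fin m → Fin 3) i j →
            strip σ ρ (suc i) j ≡ strip σ ρ (inject₁ i) (reflect (σ i) (ρ i) j)
strip-suc σ ρ zero    j = refl
strip-suc σ ρ (suc i) j =
  cong (reflect (σ zero) (ρ zero)) (strip-suc (σ ∘ suc) (ρ ∘ suc) i j)

strip-injective : ∀ {m} (σ ρ : Fin m → Fin 3) i {j k} →
                  strip σ ρ i j ≡ strip σ ρ i k → j ≡ k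
strip-injective         σ ρ zero    eq = eq
strip-injective {suc m} σ ρ (suc i) eq =
  strip-injective (σ ∘ suc) (ρ ∘ suc) i (reflect-injective (σ zero) (ρ zero) eq)

module _ {Tri : Set} where

  end-left : (c : Flag Tri) → end (left c) ≡ c
  end-left (t , i) = cong (t ,_) (next-prev i)

  left-end : (s : Flag Tri) → left (end s) ≡ s
  left-end (t , i) = cong (t ,_) (prev-next i)

-- Diagonals, angles and squares in a glued polygon.

module PolygonProperties {Tri Diagonal : Set} (lhs rhs : Diagonal → Flag Tri) where
  open Polygon lhs rhs

  HasSide : Corner → Diagonal → Set
  HasSide c d = d isSide right c ⊎ d isSide left c

  isSide⇒Glued : ∀ {d s} → d isSide s → Glued s
  isSide⇒Glued {d} (inj₁ eq) = rhs d , d , inj₁ (eq , refl)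
  isSide⇒Glued {d} (inj₂ eq) = lhs d , d , inj₂ (eq , refl)

  Glued⇒isSide : ∀ {s} → Glued s → ∃[ d ] d isSide s
  Glued⇒isSide (_ , d , inj₁ (eq , _)) = d , inj₁ eq
  Glued⇒isSide (_ , d , inj₂ (eq , _)) = d , inj₂ eq

  end-lhs↷rhs : ∀ d → end (lhs d) ↷ rhs d
  end-lhs↷rhs d = d , inj₁ (left-end (lhs d) , refl)

  end-rhs↷lhs : ∀ d → end (rhs d) ↷ lhs d
  end-rhs↷lhs d = d , inj₂ (left-end (rhs d) , refl)

  -- A diagonal on the right of an angle always has another angle across it, which would precede the
  -- first one.
  First⇒Boundary : ∀ {c} → First c → Boundary (right c)
  First⇒Boundary first glued with Glued⇒isSide glued
  ... | d , inj₁ refl = first _ (end-rhs↷lhs d)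
  ... | d , inj₂ refl = first _ (end-lhs↷rhs d)

  -- Any two distinct sides of a triangle share a corner, and the angle there is the exterior one.
  exterior-angle : ∀ d {t i j} → d isSide (t , i) → Boundary (t , j) →
                   ∃[ c ] Exterior c × HasSide c d
  exterior-angle d {t} {i} {j} side boundary with around i j
  ... | here   = contradiction (isSide⇒Glued side) boundary
  ... | after  = (t , next i) , inj₁ (boundary , isSide⇒Glued side′) , inj₂ side′
    where side′ = subst (d isSide_) (sym (left-end (t , i))) side
  ... | before = (t , i) , inj₂ (isSide⇒Glued side , boundary) , inj₁ side

  HasSide⇒ϖ∈□ : ∀ {c d} → HasSide c d → ϖ c ∈ □ d
  HasSide⇒ϖ∈□ {d = d} (inj₁ (inj₁ refl)) = inj₁ ε , inj₁ refl
  HasSide⇒ϖ∈□ {d = d} (inj₁ (inj₂ refl)) =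
    inj₂ (Eq.symmetric _↷_ (Eq.return (end-lhs↷rhs d))) , inj₂ refl
  HasSide⇒ϖ∈□ {c} {d} (inj₂ (inj₁ eq)) =
    inj₂ (subst (_~ end (lhs d)) (trans (cong end (sym eq)) (end-left c)) ε)
    , inj₁ (cong triangle eq)
  HasSide⇒ϖ∈□ {c} {d} (inj₂ (inj₂ eq)) = inj₁ (Eq.return (d , inj₂ (eq , refl)))
    , inj₂ (cong triangle eq)

  module _
    (separated : ∀ {c d} → c ~ d → triangle c ≡ triangle d → c ≡ d)
    (side-unique : ∀ {s d d′} → d isSide s → d′ isSide s → d ≡ d′)
    where

    -- By `separated` a triangle has only one corner at a given vertex. In a triangle containing
    -- `d`, the corner at an endpoint of `d` is therefore the one adjacent to `d`.
    ϖ∈□⇒HasSide : ∀ {c d} → ϖ c ∈ □ d → HasSide c d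
    ϖ∈□⇒HasSide {c} {d} (inj₁ c~ , inj₁ eq) =
      inj₁ (inj₁ (separated c~ eq))
    ϖ∈□⇒HasSide {c} {d} (inj₁ c~ , inj₂ eq) =
      inj₂ (inj₂ (trans (cong left (separated c~end-rhs eq)) (left-end (rhs d))))
      where c~end-rhs = c~ ◅◅ Eq.symmetric _↷_ (Eq.return (end-rhs↷lhs d))
    ϖ∈□⇒HasSide {c} {d} (inj₂ c~ , inj₁ eq) =
      inj₂ (inj₁ (trans (cong left (separated c~ eq)) (left-end (lhs d))))
    ϖ∈□⇒HasSide {c} {d} (inj₂ c~ , inj₂ eq) =
      inj₁ (inj₂ (separated (c~ ◅◅ Eq.return (end-lhs↷rhs d)) eq))

    exterior-unique : ∀ {c d d′} → Exterior c → HasSide c d → HasSide c d′ → d ≡ d′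
    exterior-unique (inj₁ (b , g)) (inj₁ p) _        = contradiction (isSide⇒Glued p) b
    exterior-unique (inj₁ (b , g)) (inj₂ p) (inj₁ q) = contradiction (isSide⇒Glued q) b
    exterior-unique (inj₁ (b , g)) (inj₂ p) (inj₂ q) = side-unique p q
    exterior-unique (inj₂ (g , b)) (inj₁ p) (inj₁ q) = side-unique p q
    exterior-unique (inj₂ (g , b)) (inj₁ p) (inj₂ q) = contradiction (isSide⇒Glued q) b
    exterior-unique (inj₂ (g , b)) (inj₂ p) _        = contradiction (isSide⇒Glued p) b

    -- Comparing `Q` with the matchings `A₋` and `A`.

    module Matched
      {A₋ : Pred Corner 0ℓ} (minimal : Minimal A₋)
      {E : EdgeSet} (E-perfect : PerfectMatching E)
      -- `Q` labels the squares whose union is B_E. A priori I(E), which is `Squares-in (⋃□ Q)`,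
      -- could be larger than `Q`.
      {Q : Pred Diagonal 0ℓ} (Q? : Decidable Q)
      (A₋⊖E≐∂Q : (ϖ-image A₋ ⊖ E) ≐ ∂□ Q)
      where

      open Minimal minimal using (first)
      open PerfectMatching E-perfect

      A : Pred Corner 0ℓ
      A = ϖ⁻¹ E

      A₋⇒ϖ-image : ∀ {c} → c ∈ A₋ → ϖ c ∈ ϖ-image A₋
      A₋⇒ϖ-image c∈ = _ , c∈ , ε , refl

      ϖ-image⇒A₋ : ∀ {c} → ϖ c ∈ ϖ-image A₋ → c ∈ A₋
      ϖ-image⇒A₋ (d , d∈ , d~c , eq) = subst A₋ (separated d~c eq) d∈

      ⊖⇒∂Q : ∀ {c} → c ∈ A₋ ⊖ A → ϖ c ∈ ∂□ Q
      ⊖⇒∂Q (inj₁ (c∈ , c∉)) = proj₁ A₋⊖E≐∂Q (inj₁ (A₋⇒ϖ-image c∈ , c∉))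
      ⊖⇒∂Q (inj₂ (c∈ , c∉)) = proj₁ A₋⊖E≐∂Q (inj₂ (c∈ , c∉ ∘ ϖ-image⇒A₋))

      ∂Q⇒⊖ : ∀ {c} → ϖ c ∈ ∂□ Q → c ∈ A₋ ⊖ A
      ∂Q⇒⊖ c∈∂ with proj₂ A₋⊖E≐∂Q c∈∂
      ... | inj₁ (c∈ , c∉) = inj₁ (ϖ-image⇒A₋ c∈ , c∉)
      ... | inj₂ (c∈ , c∉) = inj₂ (c∈ , c∉ ∘ A₋⇒ϖ-image)

      exterior⇒Q : ∀ {c d} → Exterior c → HasSide c d → c ∈ A₋ ⊖ A → d ∈ Q
      exterior⇒Q ext side c∈ with ⊖⇒∂Q c∈
      ... | d′ , (d′∈Q , c∈□) , _ =
        subst Q (exterior-unique ext (ϖ∈□⇒HasSide c∈□) side) d′∈Q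

      Q⇒⊖ : ∀ {c d} → Exterior c → HasSide c d → d ∈ Q → c ∈ A₋ ⊖ A
      Q⇒⊖ ext side d∈Q = ∂Q⇒⊖ (_ , (d∈Q , HasSide⇒ϖ∈□ side) ,
        λ (_ , c∈□) → exterior-unique ext side (ϖ∈□⇒HasSide c∈□))

      Y′⇒Q : ∀ {d} → d ∈ Y′ A₋ A → d ∈ Q
      Y′⇒Q (_ , c∈ , ext , side) = exterior⇒Q ext side c∈

      Q⇒Y′ : ∀ {c d} → Exterior c → HasSide c d → d ∈ Q → d ∈ Y′ A₋ A
      Q⇒Y′ ext side d∈Q = _ , Q⇒⊖ ext side d∈Q , ext , side

      Q⇒Squares : ∀ {d} → d ∈ Q → d ∈ Squares-in (⋃□ Q)
      Q⇒Squares d∈Q e∈□ = _ , d∈Q , e∈□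

      -- Neighbouring squares cannot cover the square of `d` between them: its edge at an exterior
      -- angle lies in no other square.
      exterior-Squares⇒Q : ∀ {c d} → Exterior c → HasSide c d →
                           d ∈ Squares-in (⋃□ Q) → d ∈ Q
      exterior-Squares⇒Q ext side □⊆ with □⊆ (HasSide⇒ϖ∈□ side)
      ... | d′ , d′∈Q , c∈□ = subst Q (exterior-unique ext (ϖ∈□⇒HasSide c∈□) side) d′∈Q

      -- The last two angles c₃ ↷ c₄ at a boundary vertex, c₃ between τ and ζ
      -- and c₄ between ζ and a boundary segment.  Neither is in A₋, so c₄ is in
      -- A iff ζ ∈ Q, and c₃ is in A iff exactly one of τ and ζ is in Q.

      module LastAngles {τ ζ : Diagonal}
        (τ-side : τ isSide right (end (rhs ζ)))
        (boundary : Boundary (left (lhs ζ)))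
        where

        c₃ c₄ : Corner
        c₃ = end (rhs ζ)
        c₄ = lhs ζ

        c₃~c₄ : c₃ ~ c₄
        c₃~c₄ = Eq.return (end-rhs↷lhs ζ)

        ζ-side-c₃ : ζ isSide left c₃
        ζ-side-c₃ = inj₂ (left-end (rhs ζ))

        ζ-side-c₄ : ζ isSide right c₄
        ζ-side-c₄ = inj₁ refl

        exterior-c₄ : Exterior c₄
        exterior-c₄ = inj₂ (isSide⇒Glued ζ-side-c₄ , boundary)

        -- At a boundary vertex `A₋` takes the first angle, which has no diagonal on its right, but
        -- τ is on the right of `c₃`.
        c₃∉A₋ : c₃ ∉ A₋
        c₃∉A₋ c∈ = First⇒Boundary
          (first c₃ c∈ (c₃ , ε , inj₁ (isSide⇒Glued τ-side))
            (c₄ , Eq.symmetric _↷_ c₃~c₄ , inj₂ boundary))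
          (isSide⇒Glued τ-side)

        c₄∉A₋ : c₄ ∉ A₋
        c₄∉A₋ c∈ = First⇒Boundary
          (first c₄ c∈ (c₄ , ε , inj₁ (isSide⇒Glued ζ-side-c₄)) (c₄ , ε , inj₂ boundary))
          (isSide⇒Glued ζ-side-c₄)

        ∉A₋-⊖⇒A : ∀ {c} → c ∉ A₋ → c ∈ A₋ ⊖ A → c ∈ A
        ∉A₋-⊖⇒A c∉ (inj₁ (c∈ , _)) = contradiction c∈ c∉
        ∉A₋-⊖⇒A c∉ (inj₂ (c∈ , _)) = c∈

        c₄∈A⇒ζ∈Q : c₄ ∈ A → ζ ∈ Q
        c₄∈A⇒ζ∈Q c∈ = exterior⇒Q exterior-c₄ (inj₁ ζ-side-c₄) (inj₂ (c∈ , c₄∉A₋))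

        ζ∈Q⇒c₄∈A : ζ ∈ Q → c₄ ∈ A
        ζ∈Q⇒c₄∈A ζ∈Q = ∉A₋-⊖⇒A c₄∉A₋ (Q⇒⊖ exterior-c₄ (inj₁ ζ-side-c₄) ζ∈Q)

        -- `E` matches the common vertex to a single triangle, so by `separated` the two angles
        -- would coincide. But the left side of `c₃` is ζ and that of `c₄` is a boundary segment.
        ¬both : c₃ ∈ A → c₄ ∉ A
        ¬both c₃∈ c₄∈ = boundary (subst (Glued ∘ left) c₃≡c₄ (isSide⇒Glued ζ-side-c₃))
          where
          t≡ : ∃[ t ] t ≡ triangle c₃ × t ≡ triangle c₄
          t≡ with at-black c₃ (c₃ , ε , inj₁ (isSide⇒Glued τ-side))
          ... | t , _ , unique =
            t , unique c₃∈ , unique (resp (Eq.symmetric _↷_ c₃~c₄) c₄∈)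
          c₃≡c₄ : c₃ ≡ c₄
          c₃≡c₄ = separated c₃~c₄
            (trans (sym (proj₁ (proj₂ t≡))) (proj₂ (proj₂ t≡)))

        sides-c₃ : ∀ {d} → ϖ c₃ ∈ □ d → d ≡ τ ⊎ d ≡ ζ
        sides-c₃ c₃∈□ with ϖ∈□⇒HasSide c₃∈□
        ... | inj₁ side = inj₁ (side-unique side τ-side)
        ... | inj₂ side = inj₂ (side-unique side ζ-side-c₃)

        c₃∈□τ : ϖ c₃ ∈ □ τ
        c₃∈□τ = HasSide⇒ϖ∈□ {c₃} (inj₁ τ-side)

        c₃∈□ζ : ϖ c₃ ∈ □ ζ
        c₃∈□ζ = HasSide⇒ϖ∈□ {c₃} (inj₂ ζ-side-c₃)

        ∂Q⇒c₃∈A : ϖ c₃ ∈ ∂□ Q → c₃ ∈ A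
        ∂Q⇒c₃∈A = ∉A₋-⊖⇒A c₃∉A₋ ∘ ∂Q⇒⊖

        only-ζ⇒c₃∈A : ζ ∈ Q → τ ∉ Q → c₃ ∈ A
        only-ζ⇒c₃∈A ζ∈Q τ∉Q = ∂Q⇒c₃∈A (ζ , (ζ∈Q , c₃∈□ζ) , unique)
          where
          unique : ∀ {d} → d ∈ Q × ϖ c₃ ∈ □ d → ζ ≡ d
          unique (d∈Q , c₃∈□) with sides-c₃ c₃∈□
          ... | inj₁ refl = contradiction d∈Q τ∉Q
          ... | inj₂ refl = refl

        only-τ⇒c₃∈A : τ ∈ Q → ζ ∉ Q → c₃ ∈ A
        only-τ⇒c₃∈A τ∈Q ζ∉Q = ∂Q⇒c₃∈A (τ , (τ∈Q , c₃∈□τ) , unique)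
          where
          unique : ∀ {d} → d ∈ Q × ϖ c₃ ∈ □ d → τ ≡ d
          unique (d∈Q , c₃∈□) with sides-c₃ c₃∈□
          ... | inj₁ refl = refl
          ... | inj₂ refl = contradiction d∈Q ζ∉Q

        -- If ζ were in `Q` without τ, both `c₃` and `c₄` would be in `A`.
        ζ∈Q⇒τ∈Q : ζ ∈ Q → τ ∈ Q
        ζ∈Q⇒τ∈Q ζ∈Q with Q? τ
        ... | yes τ∈Q = τ∈Q
        ... | no τ∉Q  = contradiction (ζ∈Q⇒c₄∈A ζ∈Q) (¬both (only-ζ⇒c₃∈A ζ∈Q τ∉Q))

        c₄∈A⇒τ∈Q : c₄ ∈ A → τ ∈ Q
        c₄∈A⇒τ∈Q = ζ∈Q⇒τ∈Q ∘ c₄∈A⇒ζ∈Q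

        c₃∈A⇒τ∈Q : c₃ ∈ A → τ ∈ Q
        c₃∈A⇒τ∈Q c₃∈ with ⊖⇒∂Q (inj₂ (c₃∈ , c₃∉A₋))
        ... | d , (d∈Q , c₃∈□) , _ with sides-c₃ c₃∈□
        ... | inj₁ refl = d∈Q
        ... | inj₂ refl = ζ∈Q⇒τ∈Q d∈Q

        τ∈Q⇒c₃∈A⊎c₄∈A : τ ∈ Q → c₃ ∈ A ⊎ c₄ ∈ A
        τ∈Q⇒c₃∈A⊎c₄∈A τ∈Q with Q? ζ
        ... | yes ζ∈Q = inj₂ (ζ∈Q⇒c₄∈A ζ∈Q)
        ... | no ζ∉Q  = inj₁ (only-τ⇒c₃∈A τ∈Q ζ∉Q)

        -- The edge of `c₃` lies in the squares of τ and ζ only. Covering it puts one of them in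
        -- `Q`, and ζ brings τ with it.
        τ-Squares⇒Q : τ ∈ Squares-in (⋃□ Q) → τ ∈ Q
        τ-Squares⇒Q □⊆ with □⊆ c₃∈□τ
        ... | d , d∈Q , c₃∈□ with sides-c₃ c₃∈□
        ... | inj₁ refl = d∈Q
        ... | inj₂ refl = ζ∈Q⇒τ∈Q d∈Q

-- A diagonal of the strip is the entry or the exit of a triangle that is neither first nor last,
-- except when the strip has only one diagonal.
side-of-middle : ∀ {m} (i : Fin (suc m)) →
                 (∃[ k ] (i ≡ inject₁ k ⊎ i ≡ suc k)) ⊎ (suc m ≡ 1 × i ≡ zero)
side-of-middle {zero}  zero    = inj₂ (refl , refl)
side-of-middle {suc m} zero    = inj₁ (zero , inj₁ refl)
side-of-middle         (suc k) = inj₁ (k , inj₂ refl)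

singleton : ∀ {m} → m ≡ 1 → (i j : Fin m) → i ≡ j
singleton refl zero zero = refl

-- This rests on the convention that a single notched end is called p.
pq⊎plain-q : ∀ t → t ≡ ⟨pq⟩ ⊎ ¬ T (notched-at t at-q)
pq⊎plain-q ⟨⟩   = inj₂ id
pq⊎plain-q ⟨p⟩  = inj₂ id
pq⊎plain-q ⟨pq⟩ = inj₁ refl

-- The gluing of T_δ: each side carries at most one diagonal.

module Polygon-T_δ {𝕋 : TaggedTriangulation} (a1 : TaggedTriangulation.A1 𝕋)
  (δ : TaggedArc 𝕋) (a2 : TaggedArc.A2 δ) where

  open TaggedTriangulation 𝕋
    using (mate; mate-involutive; ccw; cw; cw-~; _≟_; Enclosed; loop)
    renaming (Corner to Corner⁰; _~_ to _~⁰_)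
  open TaggedArc δ
  open T_δ δ
  open PolygonProperties lhs rhs

  idx : Flag (TaggedTriangulation.Tri 𝕋) → Fin 3
  idx = proj₂

  ccw-cw : ∀ c → ccw (cw c) ≡ c
  ccw-cw c = trans (cong mate (left-end (mate c))) (mate-involutive c)

  cw-ccw : ∀ c → cw (ccw c) ≡ c
  cw-ccw c = trans (cong end (mate-involutive (left c))) (end-left c)

  -- By A1 the loop around an enclosed puncture stands for a 1-notched arc of T
  -- with its notched end there, against A2.  Hence at least two triangles meet
  -- at a notched end of δ.

  ¬enclosed : ∀ {e c} → .(Notched e) → c ~⁰ endpoint e → ¬ Enclosed c
  ¬enclosed {e} {c} ν c~e enc = ⊥-elim-irr (a2 e ν notched-arc c~e)
    where
    notched-arc : TaggedTriangulation.ArcOfT 𝕋 c true false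
    notched-arc = subst (TaggedTriangulation.ArcOfT 𝕋 c true)
      (proj₁ a1 (loop enc)) (loop enc)

  ccw≢ : ∀ {e c} → .(Notched e) → .(c ~⁰ endpoint e) → ccw c ≢ c
  ccw≢ ν c~e eq = ⊥-elim-irr
    (¬enclosed ν c~e (trans (cong mate (sym eq)) (mate-involutive _)))

  cw≢ : ∀ {e c} → .(Notched e) → .(c ~⁰ endpoint e) → cw c ≢ c
  cw≢ {c = c} ν c~e eq = ccw≢ ν c~e (trans (cong ccw (sym eq)) (ccw-cw c))

  CornerAt-≡ : ∀ {e} {c d : CornerAt e} → value c ≡ value d → c ≡ d
  CornerAt-≡ refl = refl

  at-endpoint : ∀ e → CornerAt e
  at-endpoint e = endpoint e , Irrelevant.[ ε ]

  turn-cw : (e : End) → .(Notched e) → CornerAt e → CornerAt e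
  turn-cw e ν (c , Irrelevant.[ c~e ]) =
    cw c , Irrelevant.[ cw-~ (λ d d~c → at-puncture e ν d (d~c ◅◅ c~e)) ◅◅ c~e ]

  turn-turn-cw : ∀ e .(ν : Notched e) c → turn e ν (turn-cw e ν c) ≡ c
  turn-turn-cw e ν c = CornerAt-≡ (ccw-cw (value c))

  hub-injective : ∀ {e e′} → hub e ≡ hub e′ → e ≡ e′
  hub-injective {at-p} {at-p} _ = refl
  hub-injective {at-q} {at-q} _ = refl

  △-injective : ∀ {i j} → △ i ≡ △ j → i ≡ j
  △-injective refl = refl

  copy-cases : ∀ e .(ν : Notched e) c →
               (copy e ν c ≡ △ (hub e) × value c ≡ endpoint e) ⊎
               (∃[ pf ] copy e ν c ≡ ring e ν (value c , pf))
  copy-cases e ν c with value c ≟ endpoint e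
  ... | yes c≡e = inj₁ (refl , c≡e)
  ... | no c≢e  = inj₂ (_ , refl)

  copy≡△ : ∀ {e} .{ν : Notched e} {c i} → copy e ν c ≡ △ i →
           value c ≡ endpoint e × i ≡ hub e
  copy≡△ {e} {c = c} eq with value c ≟ endpoint e
  copy≡△ refl | yes c≡e = c≡e , refl
  copy≡△ ()   | no _

  ring-injective : ∀ {e e′} .{ν : Notched e} .{ν′ : Notched e′} {c c′} →
                   ring e ν c ≡ ring e′ ν′ c′ → e ≡ e′ × value c ≡ value c′
  ring-injective refl = refl , refl

  copy-injective : ∀ {e e′} .{ν : Notched e} .{ν′ : Notched e′} {c c′} →
                   copy e ν c ≡ copy e′ ν′ c′ → e ≡ e′ × value c ≡ value c′
  copy-injective {e} {e′} {c = c} {c′} eq with value c ≟ endpoint e | value c′ ≟ endpoint e′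
  ... | yes c≡e | yes c′≡e′ with hub-injective {e} {e′} (△-injective eq)
  ...   | refl = refl , trans c≡e (sym c′≡e′)
  copy-injective eq | no _ | no _ = ring-injective eq
  copy-injective () | yes _ | no _
  copy-injective () | no _ | yes _

  rhs-turn-cw : ∀ e .(ν : Notched e) c →
                rhs (spoke e ν (turn-cw e ν c)) ≡ (copy e ν c , idx (value c))
  rhs-turn-cw e ν c =
    cong (λ d → copy e ν d , idx (value d)) (turn-turn-cw e ν c)

  -- A ring meets the strip only in its hub triangle, and there γ passes through the side opposite
  -- to the endpoint.
  τ-opposite : ∀ {e i j} .{ν : Notched e} {c} → τ i isSide (copy e ν c , j) →
               j ≡ next (idx (value c))
  τ-opposite {at-p} {ν = ν} {c} (inj₁ eq) =
    contradiction (sym (proj₂ (copy≡△ {at-p} {ν} {c} (cong proj₁ eq)))) Fin.fromℕ≢inject₁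
  τ-opposite {at-q} {i} {ν = ν} {c} (inj₁ eq) =
    trans (cong proj₂ eq) (lemma i (copy≡△ {at-q} {ν} {c} (cong proj₁ eq)))
    where
    lemma : ∀ i → value c ≡ q × inject₁ i ≡ zero → idx (s i) ≡ next (idx (value c))
    lemma zero (refl , _) = sym (next-prev _)
  τ-opposite {at-p} {i} {ν = ν} {c} (inj₂ eq) =
    trans (cong proj₂ eq) (lemma (copy≡△ {at-p} {ν} {c} (cong proj₁ eq)))
    where
    lemma : value c ≡ p × suc i ≡ fromℕ n → idx (mate (s i)) ≡ next (idx (value c))
    lemma (refl , refl) = sym (next-prev _)
  τ-opposite {at-q} {ν = ν} {c} (inj₂ eq) =
    contradiction (sym (proj₂ (copy≡△ {at-q} {ν} {c} (cong proj₁ eq)))) Fin.0≢1+n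

  spoke-side : ∀ {e e′ j} .{ν : Notched e} .{ν′ : Notched e′} {c c′} →
               spoke e′ ν′ c′ isSide (copy e ν c , j) → j ≢ next (idx (value c))
  spoke-side {c = c} {c′} (inj₁ eq) refl
    with copy-injective {c = c} {c′} (cong proj₁ eq)
  ... | refl , refl = next≢prev (idx (value c)) (cong proj₂ eq)
  spoke-side {e′ = e′} {ν′ = ν′} {c} {c′} (inj₂ eq) refl
    with copy-injective {c = c} {turn e′ ν′ c′} (cong proj₁ eq)
  ... | refl , refl = next≢ (idx (value c)) (cong proj₂ eq)

  -- Around a notched end the spokes occupy the two sides at the puncture, and the strip diagonals
  -- only the opposite side.
  τ≢spoke : ∀ {i e} .{ν : Notched e} {c s′} → τ i isSide s′ → ¬ spoke e ν c isSide s′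
  τ≢spoke {e = e} {ν} {c} τ-side (inj₁ refl) =
    next≢prev (idx (value c)) (sym (τ-opposite {e} {ν = ν} {c} τ-side))
  τ≢spoke {e = e} {ν} {c} τ-side (inj₂ refl) =
    next≢ (idx (ccw (value c))) (sym (τ-opposite {e} {ν = ν} {turn e ν c} τ-side))

  -- Otherwise γ would leave a triangle through the side by which it came.
  τ-lhs≢rhs : ∀ i j → lhs (τ i) ≢ rhs (τ j)
  τ-lhs≢rhs (suc i) j eq = reduced i (cong₂ _,_
      (consecutive i)
      (trans (cong proj₂ eq) (cong (idx ∘ mate ∘ s) j≡)))
    where
    j≡ : j ≡ inject₁ i
    j≡ = sym (Fin.suc-injective (△-injective (cong proj₁ eq)))

  spoke-≡ : ∀ {e e′} .{ν : Notched e} .{ν′ : Notched e′} {c c′} →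
            e ≡ e′ → value c ≡ value c′ → spoke e ν c ≡ spoke e′ ν′ c′
  spoke-≡ refl refl = refl

  spoke-lhs≢rhs : ∀ {e e′} .{ν : Notched e} .{ν′ : Notched e′} {c c′} →
                  lhs (spoke e ν c) ≢ rhs (spoke e′ ν′ c′)
  spoke-lhs≢rhs {e′ = e′} {ν′ = ν′} {c} {c′} eq
    with copy-injective {c = c} {turn e′ ν′ c′} (cong proj₁ eq)
  ... | refl , refl = prev≢ (idx (value c)) (cong proj₂ eq)

  side-unique : ∀ {s d d′} → d isSide s → d′ isSide s → d ≡ d′
  side-unique {d = τ i} {τ j} (inj₁ refl) (inj₁ eq) =
    cong τ (Fin.inject₁-injective (△-injective (cong proj₁ eq)))
  side-unique {d = τ i} {τ j} (inj₁ refl) (inj₂ eq) = contradiction eq (τ-lhs≢rhs i j)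
  side-unique {d = τ i} {τ j} (inj₂ refl) (inj₁ eq) = contradiction (sym eq) (τ-lhs≢rhs j i)
  side-unique {d = τ i} {τ j} (inj₂ refl) (inj₂ eq) =
    cong τ (Fin.suc-injective (△-injective (cong proj₁ eq)))
  side-unique {d = τ i} {spoke e ν c} side side′ = contradiction side′ (τ≢spoke side)
  side-unique {d = spoke e ν c} {τ i} side side′ = contradiction side (τ≢spoke side′)
  side-unique {d = spoke e ν c} {spoke e′ ν′ c′} (inj₁ refl) (inj₁ eq)
    with copy-injective {c = c} {c′} (cong proj₁ eq)
  ... | e≡ , c≡ = spoke-≡ e≡ c≡
  side-unique {d = spoke e ν c} {spoke e′ ν′ c′} (inj₁ refl) (inj₂ eq) =
    contradiction eq (spoke-lhs≢rhs {c = c} {c′})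
  side-unique {d = spoke e ν c} {spoke e′ ν′ c′} (inj₂ refl) (inj₁ eq) =
    contradiction (sym eq) (spoke-lhs≢rhs {c = c′} {c})
  side-unique {d = spoke e ν c} {spoke e′ ν′ c′} (inj₂ refl) (inj₂ eq)
    with copy-injective {c = turn e ν c} {turn e′ ν′ c′} (cong proj₁ eq)
  ... | e≡ , ccw≡ =
    spoke-≡ e≡ (trans (sym (cw-ccw (value c))) (trans (cong cw ccw≡) (cw-ccw (value c′))))

  -- A colouring that separates the vertices of each triangle.

  -- Triangles are coloured along the strip △ 0, …, △ n, neighbours by
  -- reflection, which gives a 3-colouring.  A vertex of a ring that is not on
  -- the strip gets a colour of its own, named by the corner preceding the spoke
  -- that ends there.  Far apart vertices may share a colour.

  Colour : Set
  Colour = Fin 3 ⊎ Corner⁰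

  triangle-colour : Fin (suc n) → Fin 3 → Fin 3
  triangle-colour = strip (idx ∘ s) (idx ∘ mate ∘ s)

  hub-colour : (e : End) → (Fin 3 → Fin 3) → Colour
  hub-colour e f = inj₁ (triangle-colour (hub e) (f (idx (endpoint e))))

  -- This is the colour of the outer end of the spoke following `c`. The spokes following the
  -- endpoint and its predecessor are sides of the hub, so their outer ends already have strip
  -- colours.
  rim-colour : End → Corner⁰ → Colour
  rim-colour e c with c ≟ endpoint e | c ≟ cw (endpoint e)
  ... | yes _ | _     = hub-colour e prev
  ... | no _  | yes _ = hub-colour e next
  ... | no _  | no _  = inj₂ c

  colour : Corner → Colour
  colour (△ i , j)        = inj₁ (triangle-colour i j)
  colour (ring e ν c , j) = select (idx (value c))
    (hub-colour e id) (rim-colour e (cw (value c))) (rim-colour e (value c)) j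

  hub-colour-injective : ∀ e {f g : Fin 3 → Fin 3} → hub-colour e f ≡ hub-colour e g →
                         f (idx (endpoint e)) ≡ g (idx (endpoint e))
  hub-colour-injective e = strip-injective _ _ (hub e) ∘ inj₁-injective

  rim≢hub : ∀ e c → hub-colour e id ≢ rim-colour e c
  rim≢hub e c with c ≟ endpoint e | c ≟ cw (endpoint e)
  ... | yes _ | _     = prev≢ _ ∘ sym ∘ hub-colour-injective e {id} {prev}
  ... | no _  | yes _ = next≢ _ ∘ sym ∘ hub-colour-injective e {id} {next}
  ... | no _  | no _  = λ ()

  -- If only two triangles meet at the puncture, both outer ends lie on the hub, at different
  -- corners. Otherwise at least one of the two has a colour of its own.
  rim≢rim-cw : ∀ e c → c ≢ endpoint e → cw c ≢ c → rim-colour e (cw c) ≢ rim-colour e c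
  rim≢rim-cw e c c≢e cw≢c
    with c ≟ endpoint e | c ≟ cw (endpoint e) | cw c ≟ endpoint e | cw c ≟ cw (endpoint e)
  ... | yes c≡e | _ | _ | _ = contradiction c≡e c≢e
  ... | no _ | yes _ | yes _ | _ = next≢prev _ ∘ sym ∘ hub-colour-injective e {prev} {next}
  ... | no _ | yes c≡ | no _ | yes cwc≡ = contradiction (trans cwc≡ (sym c≡)) cw≢c
  ... | no _ | yes _ | no _ | no _ = λ ()
  ... | no _ | no _ | yes _ | _ = λ ()
  ... | no _ | no _ | no _ | yes _ = λ ()
  ... | no _ | no _ | no _ | no _ = cw≢c ∘ inj₂-injective

  colour-injective : ∀ t {i j} → colour (t , i) ≡ colour (t , j) → i ≡ j
  colour-injective (△ k) eq = strip-injective _ _ k (inj₁-injective eq)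
  colour-injective (ring e ν (c , Irrelevant.[ pf ])) eq = select-injective (idx c)
    (rim≢hub e (cw c))
    (rim≢rim-cw e c (λ c≡e → ⊥-elim-irr (proj₂ pf c≡e)) (cw≢ ν (proj₁ pf)))
    (rim≢hub e c) eq

  rim-colour-endpoint : ∀ e {c} → c ≡ endpoint e → rim-colour e c ≡ hub-colour e prev
  rim-colour-endpoint e {c} c≡e with c ≟ endpoint e | c ≟ cw (endpoint e)
  ... | yes _  | _ = refl
  ... | no c≢e | _ = contradiction c≡e c≢e

  rim-colour-cw-endpoint : ∀ e {c} → c ≢ endpoint e → c ≡ cw (endpoint e) →
                           rim-colour e c ≡ hub-colour e next
  rim-colour-cw-endpoint e {c} c≢e c≡ with c ≟ endpoint e | c ≟ cw (endpoint e)
  ... | yes c≡e | _     = contradiction c≡e c≢e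
  ... | no _    | yes _ = refl
  ... | no _    | no c≢ = contradiction c≡ c≢

  module _ (e : End) .(ν : Notched e) (c : CornerAt e) where

    colour-puncture : colour (copy e ν c , idx (value c)) ≡ hub-colour e id
    colour-puncture with copy-cases e ν c
    ... | inj₁ (eq , refl) = cong (λ k → colour (k , idx (value c))) eq
    ... | inj₂ (_ , eq)    = trans (cong (λ k → colour (k , idx (value c))) eq)
      (select-here (idx (value c)))

    colour-next : colour (copy e ν c , next (idx (value c))) ≡ rim-colour e (cw (value c))
    colour-next with copy-cases e ν c
    ... | inj₁ (eq , refl) = trans (cong (λ k → colour (k , next (idx (value c)))) eq)
      -- `rim-colour` tests for the endpoint first, so its second case is reached only because the
      -- predecessor of the endpoint differs from it.
      (sym (rim-colour-cw-endpoint e (cw≢ {e} ν ε) refl))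
    ... | inj₂ (_ , eq)    = trans (cong (λ k → colour (k , next (idx (value c)))) eq)
      (select-after (idx (value c)))

    colour-prev : colour (copy e ν c , prev (idx (value c))) ≡ rim-colour e (value c)
    colour-prev with copy-cases e ν c
    ... | inj₁ (eq , refl) = trans (cong (λ k → colour (k , prev (idx (value c)))) eq)
      (sym (rim-colour-endpoint e refl))
    ... | inj₂ (_ , eq)    = trans (cong (λ k → colour (k , prev (idx (value c)))) eq)
      (select-before (idx (value c)))

  -- A diagonal identifies two pairs of corners. For a spoke, this is the pair at the puncture, and
  -- `colour-rhs` treats the pair at the outer end.
  colour-lhs : ∀ d → colour (end (lhs d)) ≡ colour (rhs d)
  colour-lhs (τ i) = cong inj₁ (sym (trans
    (strip-suc _ _ i (idx (mate (s i))))
    (cong (triangle-colour (inject₁ i)) (select-here (idx (mate (s i)))))))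
  colour-lhs (spoke e ν c) = trans
    (cong (λ j → colour (copy e ν c , j)) (next-prev (idx (value c))))
    (trans (colour-puncture e ν c) (sym (colour-puncture e ν (turn e ν c))))

  colour-rhs : ∀ d → colour (end (rhs d)) ≡ colour (lhs d)
  colour-rhs (τ i) = cong inj₁ (trans
    (strip-suc _ _ i (next (idx (mate (s i)))))
    (cong (triangle-colour (inject₁ i)) (select-after (idx (mate (s i))))))
  colour-rhs (spoke e ν c) = trans (colour-next e ν (turn e ν c))
    (trans (cong (rim-colour e) (cw-ccw (value c))) (sym (colour-prev e ν c)))

  colour-↷ : ∀ {c d} → c ↷ d → colour c ≡ colour d
  colour-↷ {c} (d , inj₁ (left≡ , refl)) =
    trans (cong colour (trans (sym (end-left c)) (cong end left≡))) (colour-lhs d)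
  colour-↷ {c} (d , inj₂ (left≡ , refl)) =
    trans (cong colour (trans (sym (end-left c)) (cong end left≡))) (colour-rhs d)

  colour-~ : ∀ {c d} → c ~ d → colour c ≡ colour d
  colour-~ = Eq.gfold isEquivalence colour colour-↷

  -- Colours are constant on vertices and injective on the corners of each triangle.
  separated : ∀ {c d} → c ~ d → triangle c ≡ triangle d → c ≡ d
  separated {t , _} c~d refl = cong (t ,_) (colour-injective t (colour-~ c~d))

  -- Boundary segments and exterior angles of T_δ.

  copy-boundary : ∀ {e} .(ν : Notched e) c → value c ≢ endpoint e →
                  Boundary (copy e ν c , next (idx (value c)))
  copy-boundary {e} ν c c≢e glued with Glued⇒isSide glued
  ... | τ i , side = c≢e ([ on-strip , on-strip ]′ side)
    where
    on-strip : ∀ {i j k} → (copy e ν c , j) ≡ (△ i , k) → value c ≡ endpoint e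
    on-strip eq = proj₁ (copy≡△ {e} {ν} {c} (cong proj₁ eq))
  ... | spoke e′ ν′ c′ , side = spoke-side {c = c} {c′} side refl

  middle-boundary : ∀ (i : Fin len) → ∃[ j ] Boundary (△ (suc (inject₁ i)) , j)
  middle-boundary i with third {idx (s (suc i))} {idx (mate (s (inject₁ i)))}
                          (reduced i ∘ cong₂ _,_ (consecutive i))
  ... | j , j≢exit , j≢entry = j , boundary
    where
    ≢hub : ∀ e → suc (inject₁ i) ≢ hub e
    ≢hub at-p = Fin.fromℕ≢inject₁ ∘ sym ∘ Fin.suc-injective
    ≢hub at-q ()
    boundary : Boundary (△ (suc (inject₁ i)) , j)
    boundary glued with Glued⇒isSide glued
    ... | τ k , inj₁ eq with Fin.inject₁-injective {i = suc i} {k} (△-injective (cong proj₁ eq))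
    ...   | refl = j≢exit (cong proj₂ eq)
    boundary glued | τ k , inj₂ eq with Fin.suc-injective (△-injective (cong proj₁ eq))
    ...   | refl = j≢entry (cong proj₂ eq)
    -- Spokes meet the strip only in hub triangles, and a middle triangle is not a hub.
    boundary glued | spoke e ν c , inj₁ eq =
      ≢hub e (proj₂ (copy≡△ {e} {ν} {c} (sym (cong proj₁ eq))))
    boundary glued | spoke e ν c , inj₂ eq =
      ≢hub e (proj₂ (copy≡△ {e} {ν} {turn e ν c} (sym (cong proj₁ eq))))

  -- In the first triangle the strip is glued only along the side opposite to `q`, and the spokes at
  -- p meet the strip only in the last triangle.
  plain-q-boundary : ¬ Notched at-q → Boundary (△ zero , idx q)
  plain-q-boundary plain glued with Glued⇒isSide glued
  ... | τ zero , inj₁ eq = prev≢ (idx (s zero)) (cong proj₂ eq)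
  ... | spoke at-q ν c , _ = ⊥-elim-irr (plain ν)
  ... | spoke at-p ν c , inj₁ eq =
    Fin.0≢1+n (proj₂ (copy≡△ {at-p} {ν} {c} (sym (cong proj₁ eq))))
  ... | spoke at-p ν c , inj₂ eq =
    Fin.0≢1+n (proj₂ (copy≡△ {at-p} {ν} {turn at-p ν c} (sym (cong proj₁ eq))))

  Exceptional : Diagonal → Set
  Exceptional d = tag ≡ ⟨pq⟩ × n ≡ 1 × d ≡ τ zero

  -- The two triangles at a spoke are distinct, so one is not the hub and has a boundary segment
  -- opposite to the puncture. A strip diagonal borders a middle triangle unless n = 1, and then a
  -- plain `q` still leaves a boundary segment.
  exterior⊎exceptional : ∀ d → (∃[ c ] Exterior c × HasSide c d) ⊎ Exceptional d
  exterior⊎exceptional (spoke e ν c@(_ , Irrelevant.[ c~e ])) with toSum (value c ≟ endpoint e)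
  ... | inj₂ c≢e = inj₁ (exterior-angle (spoke e ν c) (inj₁ refl) (copy-boundary {e} ν c c≢e))
  ... | inj₁ c≡e = inj₁ (exterior-angle (spoke e ν c) (inj₂ refl) (copy-boundary {e} ν (turn e ν c)
    (λ ccw≡e → ccw≢ ν c~e (trans ccw≡e (sym c≡e)))))
  exterior⊎exceptional (τ i) with side-of-middle i
  ... | inj₁ (k , inj₁ refl) =
    inj₁ (exterior-angle (τ (inject₁ k)) (inj₂ refl) (proj₂ (middle-boundary k)))
  ... | inj₁ (k , inj₂ refl) =
    inj₁ (exterior-angle (τ (suc k)) (inj₁ refl) (proj₂ (middle-boundary k)))
  ... | inj₂ (n≡1 , refl) with pq⊎plain-q tag
  ...   | inj₁ tag≡pq = inj₂ (tag≡pq , n≡1 , refl)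
  ...   | inj₂ plain  = inj₁ (exterior-angle (τ zero) (inj₁ refl) (plain-q-boundary plain))

  -- The special angles as the last two angles at the outer end of the last spoke.

  module _ (e : End) (ν : Notched e) where

    ζ : Diagonal
    ζ = last-spoke e ν

    cw-endpoint : CornerAt e
    cw-endpoint = turn-cw e ν (at-endpoint e)

    rhs-ζ : rhs ζ ≡ (△ (hub e) , idx (endpoint e))
    rhs-ζ with copy-cases e ν (at-endpoint e)
    ... | inj₁ (eq , _) = trans (rhs-turn-cw e ν (at-endpoint e)) (cong (_, idx (endpoint e)) eq)
    ... | inj₂ (Irrelevant.[ pf ] , _) = ⊥-elim-irr (proj₂ pf refl)

    τ-side-hub : n ≡ 1 → τ zero isSide (△ (hub e) , next (idx (endpoint e)))
    τ-side-hub n≡1 = lemma e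
      where
      lemma : ∀ e → τ zero isSide (△ (hub e) , next (idx (endpoint e)))
      lemma at-q = inj₁ (cong (△ zero ,_) (next-prev _))
      -- The last triangle is entered through τₙ, which is τ₁ because n = 1.
      lemma at-p = inj₂ (trans (cong (△ (fromℕ n) ,_) (next-prev _))
        (cong (rhs ∘ τ) (singleton n≡1 (fromℕ len) zero)))

    τ-side : n ≡ 1 → τ zero isSide right (end (rhs ζ))
    τ-side n≡1 = subst (λ c → τ zero isSide end c) (sym rhs-ζ) (τ-side-hub n≡1)

    -- Left of the outer corner is the side opposite to the puncture, in the triangle before the
    -- hub.
    ζ-boundary : Boundary (left (lhs ζ))
    ζ-boundary = subst (λ j → Boundary (copy e ν cw-endpoint , j))
      (sym (prev-prev (idx (cw (endpoint e)))))
      (copy-boundary {e} ν cw-endpoint (cw≢ {e} ν ε))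

    Target : Pred Side 0ℓ
    Target s′ = τ zero isSide s′ ⊎ Boundary s′

    spoke∉Target : ∀ {c s′} → spoke e ν c isSide s′ → s′ ∉ Target
    spoke∉Target side (inj₁ τ-side) = τ≢spoke τ-side side
    spoke∉Target {c} side (inj₂ boundary) = boundary (isSide⇒Glued {spoke e ν c} side)

    -- Of the four angles at ζ, the two at the puncture have another spoke as their second side,
    -- which is neither τ₁ nor a boundary segment.
    special⇒last-angle : ∀ {c} → AngleBetween (ζ isSide_) Target c →
                         c ≡ end (rhs ζ) ⊎ c ≡ lhs ζ
    special⇒last-angle (inj₁ (inj₁ c≡ , _)) = inj₂ c≡
    -- The angle of the hub at the puncture: its left side is the spoke following the endpoint.
    special⇒last-angle (inj₁ (inj₂ refl , target)) = contradiction target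
      (spoke∉Target {at-endpoint e} (inj₁ (cong (λ c → left (copy e ν c , idx (value c)))
        (turn-turn-cw e ν (at-endpoint e)))))
    -- The angle before the hub at the puncture: its right side is the spoke preceding ζ.
    special⇒last-angle {c} (inj₂ (target , inj₁ left≡)) = contradiction target
      (spoke∉Target {turn-cw e ν cw-endpoint} (inj₂ (trans
        (trans (sym (end-left c)) (cong end left≡))
        (trans (cong (copy e ν cw-endpoint ,_) (next-prev _))
          (sym (rhs-turn-cw e ν cw-endpoint))))))
    special⇒last-angle {c} (inj₂ (_ , inj₂ left≡)) =
      inj₁ (trans (sym (end-left c)) (cong end left≡))

    first-special : n ≡ 1 → AngleBetween (ζ isSide_) Target (end (rhs ζ))
    first-special n≡1 = inj₂ (inj₁ (τ-side n≡1) , inj₂ (left-end (rhs ζ)))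

    last-special : AngleBetween (ζ isSide_) Target (lhs ζ)
    last-special = inj₁ (inj₁ refl , inj₂ ζ-boundary)

  -- Equality of the three sets of diagonals.

  module _
    {A₋ : Pred Corner 0ℓ} (minimal : Minimal A₋)
    {E : EdgeSet} (E-perfect : PerfectMatching E)
    {Q : Pred Diagonal 0ℓ} (Q? : Decidable Q)
    (A₋⊖E≐∂Q : (ϖ-image A₋ ⊖ E) ≐ ∂□ Q)
    where

    open Matched separated side-unique minimal E-perfect Q? A₋⊖E≐∂Q

    module Last (n≡1 : n ≡ 1) (e : End) (ν : Notched e) =
      LastAngles {τ zero} {ζ e ν} (τ-side e ν n≡1) (ζ-boundary e ν)

    both-notched : tag ≡ ⟨pq⟩ → Notched at-p
    both-notched tag≡pq = subst (λ t → T (notched-at t at-p)) (sym tag≡pq) _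

    Squares⇒Q : ∀ {d} → d ∈ Squares-in (⋃□ Q) → d ∈ Q
    Squares⇒Q {d} □⊆ with exterior⊎exceptional d
    ... | inj₁ (_ , ext , side) = exterior-Squares⇒Q ext side □⊆
    ... | inj₂ (tag≡pq , n≡1 , refl) =
      Last.τ-Squares⇒Q n≡1 at-p (both-notched tag≡pq) □⊆

    Q⇒Y : ∀ {d} → d ∈ Q → d ∈ Y A₋ (ϖ⁻¹ E)
    Q⇒Y {d} d∈Q with exterior⊎exceptional d
    ... | inj₁ (_ , ext , side) = inj₁ (Q⇒Y′ ext side d∈Q)
    ... | inj₂ (tag≡pq , n≡1 , refl) =
      inj₂ (tag≡pq , n≡1 , special (Last.τ∈Q⇒c₃∈A⊎c₄∈A n≡1 at-p ν d∈Q) , refl)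
      where
      ν = both-notched tag≡pq
      special : end (rhs (ζ at-p ν)) ∈ A ⊎ lhs (ζ at-p ν) ∈ A →
                ∃[ c ] c ∈ A × c ∈ Special
      special (inj₁ c₃∈) = _ , c₃∈ , at-p , ν , first-special at-p ν n≡1
      special (inj₂ c₄∈) = _ , c₄∈ , at-p , ν , last-special at-p ν

    -- A special angle may be at either end; with n = 1 both hub triangles contain τ₁, so `Last`
    -- applies at each.
    Y⇒Q : ∀ {d} → d ∈ Y A₋ (ϖ⁻¹ E) → d ∈ Q
    Y⇒Q (inj₁ d∈Y′) = Y′⇒Q d∈Y′
    Y⇒Q (inj₂ (tag≡pq , n≡1 , (c , c∈ , e , ν , between) , refl))
      with special⇒last-angle e ν between
    ... | inj₁ refl = Last.c₃∈A⇒τ∈Q n≡1 e ν c∈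
    ... | inj₂ refl = Last.c₄∈A⇒τ∈Q n≡1 e ν c∈

    Squares≐Y : Squares-in (⋃□ Q) ≐ Y A₋ (ϖ⁻¹ E)
    Squares≐Y = (λ d∈ → Q⇒Y (Squares⇒Q d∈)) , (λ d∈ → Q⇒Squares (Y⇒Q d∈))

proposition1p7 : (𝕋 : TaggedTriangulation) → TaggedTriangulation.A1 𝕋 →
    (δ : TaggedArc 𝕋) → TaggedArc.A2 δ →
    let open T_δ δ in
    (A₋ : Pred Corner 0ℓ) → Minimal A₋ →
    (E : EdgeSet) → PerfectMatching E →
    (Q : Pred Diagonal 0ℓ) → Decidable Q → (ϖ-image A₋ ⊖ E) ≐ ∂□ Q →
    Squares-in (⋃□ Q) ≐ Y A₋ (ϖ⁻¹ E)
proposition1p7 𝕋 a1 δ a2 A₋ minimal E E-perfect Q Q? =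
  Polygon-T_δ.Squares≐Y a1 δ a2 minimal E-perfect Q?
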